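{- Let $U$ be a nonempty finite set. For every closure operation $f\in Cl(U)$, the set of all antikeys of $f$ equals the family of complements of the minimal independent sets of $f$: $$Antikey(f)=\overline{MI(f)}.$$
   Context: Let $U$ be a nonempty finite set with power set $\mathcal{P}(U)$. A closure operation on $U$ is a map $f:\mathcal{P}(U)\to\mathcal{P}(U)$ such that for all $X,Y\subseteq U$: $X\subseteq f(X)$; $X\subseteq Y$ implies $f(X)\subseteq f(Y)$; and $f(f(X))=f(X)$. $Cl(U)$ is the set of all closure operations on $U$. A set $A\subseteq U$ is an antikey of $f$ if $f(A)\neq U$ and $f(A\cup\{a\})=U$ for all $a\in U\setminus A$. $Antikey(f)$ is the set of all antikeys of $f$. For $X\subseteq U$ put $I(X)=\{a\in U: a\notin f(X)\}=U\setminus f(X)$; such a set is called an independent set of $f$, and $I(f)=\{I(X):X\subseteq U\}$ is the family of all independent sets of $f$. $MI(f)$, the family of all minimal independent sets of $f$, consists of the inclusion-minimal nonempty members of $I(f)$, i.e. those $Y\in I(f)$ with $Y\neq\emptyset$ such that no nonempty $Z\in I(f)$ satisfies $Z\subsetneq Y$. For a family $\mathcal{S}\subseteq\mathcal{P}(U)$, $\overline{\mathcal{S}}=\{U\setminus Y: Y\in\mathcal{S}\}$ denotes the family of complements of members of $\mathcal{S}$. -}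

module Defs where

open import Data.Nat.Base using (ℕ)
open import Data.Fin.Subset using (Subset; ⊤; ∁; ⁅_⁆; _∪_; _∉_; _⊆_; _⊂_; Nonempty)
open import Data.Product.Base using (∃-syntax; _×_)
open import Level using (0ℓ)
open import Relation.Binary.PropositionalEquality using (_≡_; _≢_)
open import Relation.Nullary using (¬_)
open import Relation.Unary using (Pred)

-- The ground set U is Fin n, its power set is Subset n, and U itself, as a
-- subset, is ⊤.

Family : ℕ → Set₁
Family n = Pred (Subset n) 0ℓ

record ClosureOperation (n : ℕ) : Set where
  field
    cl         : Subset n → Subset n
    extensive  : ∀ X → X ⊆ cl X
    monotone   : ∀ X Y → X ⊆ Y → cl X ⊆ cl Y
    idempotent : ∀ X → cl (cl X) ≡ cl X

open ClosureOperation public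

module _ {n : ℕ} where

  Antikey : ClosureOperation n → Family n
  Antikey f A = cl f A ≢ ⊤ × (∀ a → a ∉ A → cl f (A ∪ ⁅ a ⁆) ≡ ⊤)

  I : ClosureOperation n → Subset n → Subset n
  I f X = ∁ (cl f X)

  Independent : ClosureOperation n → Family n
  Independent f Y = ∃[ X ] Y ≡ I f X

  -- The empty set (independent, as I f ⊤) is excluded both as a member and as
  -- a competitor for minimality.
  MI : ClosureOperation n → Family n
  MI f Y = Independent f Y × Nonempty Y
         × (∀ Z → Independent f Z → Nonempty Z → ¬ (Z ⊂ Y))

  -- The family of complements of the members of 𝒮, not the complement of 𝒮
  -- in the power set.
  Complements : Family n → Family n
  Complements 𝒮 Z = ∃[ Y ] (𝒮 Y × Z ≡ ∁ Y)

{-# OPTIONS --safe #-}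
module Submission where

open import Defs
open import Data.Nat.Base using (ℕ; NonZero)
open import Relation.Unary using (_≐_)
open import Data.Fin.Base using (Fin)
open import Data.Fin.Subset
  using (Subset; ⊤; ∁; ⁅_⁆; _∪_; _∈_; _∉_; _⊆_; Nonempty; Empty)
open import Data.Fin.Subset.Properties
open import Data.Product.Base using (_,_)
open import Data.Sum.Base using (inj₁; inj₂)
open import Relation.Binary.PropositionalEquality
  using (_≡_; _≢_; refl; sym; trans; cong; subst)
open import Relation.Nullary using (decidable-stable)

-- The complements of the independent sets are exactly the closed sets, so the
-- claim is that the antikeys are the maximal closed proper subsets of U. An
-- antikey A is closed, since cl A ∖ A can only contain elements a with
-- U = cl (A ∪ {a}) ⊆ cl A; and a closed set strictly above A contains some
-- A ∪ {a}, hence is U. Conversely, if A is maximal among the closed proper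
-- subsets and a ∉ A, then cl (A ∪ {a}) is closed and strictly above A.

private
  variable
    n : ℕ
    x : Fin n
    p q : Subset n

∁-involutive : (p : Subset n) → ∁ (∁ p) ≡ p
∁-involutive p = ⊆-antisym
  (λ x∈∁∁p → x∉∁p⇒x∈p (x∈∁p⇒x∉p x∈∁∁p))
  (λ x∈p → x∉p⇒x∈∁p (x∈p⇒x∉∁p x∈p))

Empty-∁⇒≡⊤ : Empty (∁ p) → p ≡ ⊤
Empty-∁⇒≡⊤ ∁p-empty = ⊆-antisym ⊆⊤
  (λ {x} _ → x∉∁p⇒x∈p (λ x∈∁p → ∁p-empty (x , x∈∁p)))

≢⊤⇒Nonempty-∁ : p ≢ ⊤ → Nonempty (∁ p)
≢⊤⇒Nonempty-∁ {p = p} p≢⊤ = decidable-stable (nonempty? (∁ p))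
  (λ ∁p-empty → p≢⊤ (Empty-∁⇒≡⊤ ∁p-empty))

Nonempty-∁⇒≢⊤ : Nonempty (∁ p) → p ≢ ⊤
Nonempty-∁⇒≢⊤ (_ , x∈∁p) refl = x∈∁p⇒x∉p x∈∁p ∈⊤

∪⁅⁆-least : p ⊆ q → x ∈ q → p ∪ ⁅ x ⁆ ⊆ q
∪⁅⁆-least {p = p} {x = x} p⊆q x∈q y∈p∪x with x∈p∪q⁻ p ⁅ x ⁆ y∈p∪x
... | inj₁ y∈p = p⊆q y∈p
... | inj₂ y∈x = subst (_∈ _) (sym (x∈⁅y⁆⇒x≡y x y∈x)) x∈q

module _ (f : ClosureOperation n) where

  cl-least : ∀ {X Y} → X ⊆ cl f Y → cl f X ⊆ cl f Y
  cl-least {X} {Y} X⊆clY {x} x∈clX =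
    subst (x ∈_) (idempotent f Y) (monotone f X (cl f Y) X⊆clY x∈clX)

  -- `cl f X` contains `A ∪ ⁅ a ⁆` and hence its closure, which is `⊤`. Taking `X` to be `A` shows
  -- that `A` is closed; arbitrary `X` gives maximality.
  antikey-above : ∀ {A} → Antikey f A → ∀ {X a} →
                  A ⊆ cl f X → a ∈ cl f X → a ∉ A → cl f X ≡ ⊤
  antikey-above {A} (_ , spans) {a = a} A⊆clX a∈clX a∉A = ⊆-antisym ⊆⊤
    (subst (_⊆ _) (spans a a∉A) (cl-least (∪⁅⁆-least A⊆clX a∈clX)))

  antikey-closed : ∀ {A} → Antikey f A → cl f A ≡ A
  antikey-closed {A} A-antikey@(clA≢⊤ , _) = ⊆-antisym
    (λ {a} a∈clA → decidable-stable (a ∈? A)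
      (λ a∉A → clA≢⊤ (antikey-above A-antikey (extensive f A) a∈clA a∉A)))
    (extensive f A)

  antikey⇒∁-MI : ∀ {A} → Antikey f A → MI f (∁ A)
  antikey⇒∁-MI {A} A-antikey@(clA≢⊤ , _) =
      (A , cong ∁ (sym A-closed))
    , ≢⊤⇒Nonempty-∁ (subst (_≢ ⊤) A-closed clA≢⊤)
    -- The competitor is `∁ (cl f X)`, so the point `a` of `∁ A` that it misses lies in `cl f X` but
    -- not in `A`.
    , λ { _ (X , refl) Z-nonempty (Z⊆∁A , a , a∈∁A , a∉Z) →
          Nonempty-∁⇒≢⊤ Z-nonempty
            (antikey-above A-antikey (∁p⊆∁q⇒p⊇q Z⊆∁A)
              (x∉∁p⇒x∈p a∉Z) (x∈∁p⇒x∉p a∈∁A)) }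
    where
    A-closed = antikey-closed A-antikey

  MI⇒∁-antikey : ∀ {Y} → MI f Y → Antikey f (∁ Y)
  MI⇒∁-antikey ((X , refl) , Y-nonempty , Y-minimal) =
    subst (Antikey f) (sym (∁-involutive A)) (clA≢⊤ , spans)
    where
    A = cl f X

    clA≢⊤ : cl f A ≢ ⊤
    clA≢⊤ clA≡⊤ =
      Nonempty-∁⇒≢⊤ Y-nonempty (trans (sym (idempotent f X)) clA≡⊤)

    spans : ∀ a → a ∉ A → cl f (A ∪ ⁅ a ⁆) ≡ ⊤
    -- Otherwise `I f B` would be a nonempty independent set strictly inside `∁ A`: it omits `a`,
    -- which `∁ A` contains.
    spans a a∉A = Empty-∁⇒≡⊤ λ Z-nonempty →
      Y-minimal (I f B) (B , refl) Z-nonempty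
        (p⊂q⇒∁p⊃∁q
          ( (λ x∈A → extensive f B (p⊆p∪q ⁅ a ⁆ x∈A))
          , a , extensive f B (q⊆p∪q A ⁅ a ⁆ (x∈⁅x⁆ a)) , a∉A))
      where
      B = A ∪ ⁅ a ⁆

corollary3p2 : (n : ℕ) → .{{_ : NonZero n}} → (f : ClosureOperation n) →
    Antikey f ≐ Complements (MI f)
corollary3p2 n f =
    (λ {A} A-antikey → ∁ A , antikey⇒∁-MI f A-antikey , sym (∁-involutive A))
  , λ { (_ , Y-MI , refl) → MI⇒∁-antikey f Y-MI }
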